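{- The following identities of formal Laurent series hold: \begin{align*} \phi_{i,j}(z) & =A_{i,j}(z), \qquad i,j \ge 0,\\ \phi_{i,j}^{(1)}(z) & =A_{i,j}^{(1)}(z), \qquad i,j \ge 0,\\ \psi_{i,j}(z) & = W_{i,j}(z), \qquad i,j \in \mathbb{Z}. \end{align*}
   Context: Fix integers $p,q\geq 1$ and, for each $-p\leq k\leq q$, a bi-infinite sequence $(a^{(k)}_{n})_{n\in\mathbb{Z}}$ of complex numbers. Paths. A step is an ordered pair $(n,m)\rightarrow(n+1,m')$ with $n\in\mathbb{Z}_{\geq 0}$, $m,m'\in\mathbb{Z}$ and $-p\leq m'-m\leq q$. Its weight is $a_m^{(i)}$ if $m'=m+i$ with $0\leq i\leq q$, and $a_{m-j}^{(-j)}$ if $m'=m-j$ with $1\leq j\leq p$. A lattice path of length $k$ is a sequence of $k$ steps in which the final vertex of each step is the initial vertex of the next; a path of length zero is a single vertex. The weight $w(\gamma)$ of a path $\gamma$ is the product of the weights of its steps (and $1$ for paths of length zero). Empty sums are zero. For $n\geq 0$ and $i,j\in\mathbb{Z}$, $\mathcal{P}_{[n,i,j]}$ is the collection of all lattice paths of length $n$ with initial point $(0,i)$ and final point $(n,j)$. For $i,j\geq 0$, $\mathcal{D}_{[n,i,j]}\subset\mathcal{P}_{[n,i,j]}$ consists of the paths with no point below the $x$-axis, and $\mathcal{D}^{(1)}_{[n,i,j]}\subset\mathcal{D}_{[n,i+1,j+1]}$ consists of the paths with no point below the line $y=1$. Let $A_{[n,i,j]}$, $A^{(1)}_{[n,i,j]}$,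 $W_{[n,i,j]}$ be the sums of $w(\gamma)$ over $\gamma$ in $\mathcal{D}_{[n,i,j]}$, $\mathcal{D}^{(1)}_{[n,i,j]}$, $\mathcal{P}_{[n,i,j]}$ respectively, and $$A_{i,j}(z)=\sum_{n=0}^{\infty}\frac{A_{[n,i,j]}}{z^{n+1}},\quad A^{(1)}_{i,j}(z)=\sum_{n=0}^{\infty}\frac{A^{(1)}_{[n,i,j]}}{z^{n+1}},\quad W_{i,j}(z)=\sum_{n=0}^{\infty}\frac{W_{[n,i,j]}}{z^{n+1}}.$$ Operators. Let $\{e_n\}_{n\in\mathbb{Z}}$ be the standard basis vectors of $\ell^2(\mathbb{Z})$, with inner product $\langle\cdot,\cdot\rangle$; $\mathcal{E}=\mathrm{span}\{e_n\}_{n\in\mathbb{Z}}$ and $\mathcal{E}_0=\mathrm{span}\{e_n\}_{n\geq 0}$ (finite linear combinations). Define linear operators $\mathcal{W}:\mathcal{E}\to\mathcal{E}$ and $\mathcal{H},\mathcal{H}_1:\mathcal{E}_0\to\mathcal{E}_0$ by $$\mathcal{W}e_n=\sum_{m=1}^{q}a_{n-m}^{(m)}e_{n-m}+\sum_{m=0}^{p}a_n^{(-m)}e_{n+m},\qquad n\in\mathbb{Z},$$ $$\mathcal{H}e_n=\sum_{m=1}^{\min(n,q)}a_{n-m}^{(m)}e_{n-m}+\sum_{m=0}^{p}a_n^{(-m)}e_{n+m},\qquad n\geq 0,$$ $$\mathcal{H}_1e_n=\sum_{m=1}^{\min(n,q)}a_{n-m+1}^{(m)}e_{n-m}+\sum_{m=0}^{p}a_{n+1}^{(-m)}e_{n+m},\qquad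 n\geq 0.$$ The resolvent functions are the formal Laurent series $$\psi_{i,j}(z)=\sum_{n=0}^{\infty}\frac{\langle\mathcal{W}^ne_j,e_i\rangle}{z^{n+1}}\ (i,j\in\mathbb{Z}),\quad \phi_{i,j}(z)=\sum_{n=0}^{\infty}\frac{\langle\mathcal{H}^ne_j,e_i\rangle}{z^{n+1}},\quad \phi^{(1)}_{i,j}(z)=\sum_{n=0}^{\infty}\frac{\langle\mathcal{H}_1^ne_j,e_i\rangle}{z^{n+1}}\ (i,j\geq 0).$$ -}

module Defs where

open import Algebra.Bundles using (AbelianGroup; CommutativeRing)
open import Algebra.Morphism.Structures using (module RingMorphisms)
open import Data.Integer using (ℤ; +_; -[1+_]; _≤_; _<_)
  renaming (_+_ to _+ℤ_; _-_ to _-ℤ_; -_ to -ℤ_)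
import Algebra.Properties.Group as GroupProperties
import Data.Integer as ℤ
import Data.Integer.Properties as ℤₚ
open import Data.List using (List; []; _∷_; [_]; _++_; map; concatMap; filter; foldr; upTo; deduplicate)
open import Data.List.Membership.Propositional using (_∈_; lose)
open import Data.List.Membership.Propositional.Properties
  using (∈-map⁺; ∈-map⁻; ∈-upTo⁺; ∈-concatMap⁺; ∈-++⁺ˡ; ∈-++⁺ʳ; ∈-deduplicate⁺)
open import Data.List.Relation.Binary.Disjoint.Propositional using (Disjoint)
open import Data.List.Relation.Unary.All using (All; []; _∷_; all?; lookup; universal)
import Data.List.Relation.Unary.All.Properties as All
open import Data.List.Relation.Unary.AllPairs using ([]; _∷_)
import Data.List.Relation.Unary.AllPairs as AllPairs
import Data.List.Relation.Unary.AllPairs.Properties as AllPairs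
open import Data.List.Relation.Unary.Any using (here; there)
open import Data.List.Relation.Unary.Unique.Propositional using (Unique)
import Data.List.Relation.Unary.Unique.DecPropositional.Properties as UniqueDec
import Data.List.Relation.Unary.Unique.Propositional.Properties as Unique
open import Data.Nat using (ℕ; zero; suc; _+_; _∸_; _⊓_; s≤s)
import Data.Nat as ℕ
open import Data.Nat.GeneralisedArithmetic using (fold)
import Data.Nat.Properties as ℕₚ
open import Data.Product using (_×_; _,_; proj₂; ∃)
open import Data.Product.Properties using (≡-dec)
open import Function using (_∘_)
open import Level using (Level; _⊔_) renaming (suc to lsuc)
open import Relation.Binary using (DecidableEquality)
open import Relation.Binary.PropositionalEquality as ≡ using (_≡_; _≢_; refl)
open import Relation.Nullary using (Dec; yes; no; contradiction)
open import Relation.Nullary.Decidable using (map′; _×-dec_)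

-- The ring of scalars.  Only the commutative ring structure of ℂ, together
-- with complex conjugation (which enters through the inner product), is used.
record ConjugationRing (c ℓ : Level) : Set (lsuc (c ⊔ ℓ)) where
  field
    commutativeRing : CommutativeRing c ℓ
  open CommutativeRing commutativeRing public
  field
    conj              : Carrier → Carrier
    conj-homomorphism : RingMorphisms.IsRingHomomorphism rawRing rawRing conj
    conj-involutive   : ∀ x → conj (conj x) ≈ x

------------------------------------------------------------------------
-- Lattice paths

module LatticePaths (p q : ℕ) where

  -- (abscissa , ordinate)
  Point : Set
  Point = ℕ × ℤ

  data Step : Point → Point → Set where
    step : ∀ {n m m′} → -ℤ (+ p) ≤ m′ -ℤ m → m′ -ℤ m ≤ + q →
           Step (n , m) (suc n , m′)

  -- Path k u v: paths of length k with initial point u and final point v.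
  data Path : ℕ → Point → Point → Set where
    []  : ∀ {u} → Path zero u u
    _∷_ : ∀ {k u v w} → Step u v → Path k v w → Path (suc k) u w

  vertices : ∀ {k u v} → Path k u v → List Point
  vertices {u = u} []      = [ u ]
  vertices {u = u} (_ ∷ γ) = u ∷ vertices γ

  NoPointBelow : ℤ → ∀ {k u v} → Path k u v → Set
  NoPointBelow h γ = All (λ v → h ≤ proj₂ v) (vertices γ)

  noPointBelow? : ∀ h {k u v} (γ : Path k u v) → Dec (NoPointBelow h γ)
  noPointBelow? h γ = all? (λ v → h ℤ.≤? proj₂ v) (vertices γ)

  _≟ₚ_ : DecidableEquality Point
  _≟ₚ_ = ≡-dec ℕ._≟_ ℤ._≟_

  step? : ∀ u v → Dec (Step u v)
  step? (n , m) (n′ , m′) with n′ ℕ.≟ suc n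
  ... | no  n′≢1+n = no λ { (step _ _) → n′≢1+n refl }
  ... | yes refl   = map′ (λ (l , r) → step l r) (λ { (step l r) → l , r })
                          ((-ℤ (+ p) ℤ.≤? m′ -ℤ m) ×-dec (m′ -ℤ m ℤ.≤? + q))

  -- The points (n + 1, m - p), …, (n + 1, m + q).
  successors : Point → List Point
  successors (n , m) = map (λ t → suc n , (m -ℤ + p) +ℤ + t) (upTo (suc (p + q)))

  -- All paths of length k from u to w, each listed exactly once
  -- (see paths-complete and paths-unique).
  mutual
    paths : ∀ k u w → List (Path k u w)
    paths zero u w with u ≟ₚ w
    ... | yes refl = [ [] ]
    ... | no  _    = []
    paths (suc k) u w = concatMap (pathsVia k u w) (successors u)

    pathsVia : ∀ k u w → Point → List (Path (suc k) u w)
    pathsVia k u w v with step? u v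
    ... | yes s = map (s ∷_) (paths k v w)
    ... | no  _ = []

  private module ℤ-group = GroupProperties (AbelianGroup.group ℤₚ.+-0-abelianGroup)

  step-irrelevant : ∀ {u v} (s t : Step u v) → s ≡ t
  step-irrelevant (step l r) (step l′ r′) =
    ≡.cong₂ step (ℤₚ.≤-irrelevant l l′) (ℤₚ.≤-irrelevant r r′)

  successors-complete : ∀ {u v} → Step u v → v ∈ successors u
  successors-complete (step {n} {m} {m′} l r) =
    ≡.subst (λ y → (suc n , y) ∈ successors (n , m)) eq
      (∈-map⁺ _ (∈-upTo⁺ (s≤s (ℤₚ.drop‿+≤+ t≤p+q))))
    where
    d : ℤ
    d = (m′ -ℤ m) +ℤ + p
    0≤d : + 0 ≤ d
    0≤d = ≡.subst (_≤ d) (ℤₚ.+-inverseˡ (+ p)) (ℤₚ.+-monoˡ-≤ (+ p) l)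
    ∣d∣≡d : + ℤ.∣ d ∣ ≡ d
    ∣d∣≡d = ℤₚ.0≤i⇒+∣i∣≡i 0≤d
    t≤p+q : + ℤ.∣ d ∣ ≤ + (p + q)
    t≤p+q = ≡.subst₂ _≤_ (≡.sym ∣d∣≡d) (≡.cong +_ (ℕₚ.+-comm q p))
              (ℤₚ.+-monoˡ-≤ (+ p) r)
    open ≡.≡-Reasoning
    eq : (m -ℤ + p) +ℤ + ℤ.∣ d ∣ ≡ m′
    eq = begin
      (m -ℤ + p) +ℤ + ℤ.∣ d ∣          ≡⟨ ≡.cong ((m -ℤ + p) +ℤ_) ∣d∣≡d ⟩
      (m -ℤ + p) +ℤ d                  ≡⟨ ℤₚ.+-comm (m -ℤ + p) d ⟩
      ((m′ -ℤ m) +ℤ + p) +ℤ (m -ℤ + p) ≡⟨ ℤₚ.+-assoc (m′ -ℤ m) (+ p) _ ⟩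
      (m′ -ℤ m) +ℤ (+ p +ℤ (m -ℤ + p)) ≡⟨ ≡.cong ((m′ -ℤ m) +ℤ_) (ℤₚ.+-comm (+ p) (m -ℤ + p)) ⟩
      (m′ -ℤ m) +ℤ ((m -ℤ + p) +ℤ + p) ≡⟨ ≡.cong ((m′ -ℤ m) +ℤ_) (ℤ-group.//-rightDividesˡ (+ p) m) ⟩
      (m′ -ℤ m) +ℤ m                   ≡⟨ ℤ-group.//-rightDividesˡ m m′ ⟩
      m′                               ∎

  successors-unique : ∀ u → Unique (successors u)
  successors-unique (n , m) =
    Unique.map⁺ (λ {s} {t} e → ℤₚ.+-injective
                  (ℤ-group.∙-cancelˡ (m -ℤ + p) (+ s) (+ t) (≡.cong proj₂ e)))
                (Unique.upTo⁺ (suc (p + q)))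

  paths-complete : ∀ {k u w} (γ : Path k u w) → γ ∈ paths k u w
  paths-complete {u = u} [] with u ≟ₚ u
  ... | yes refl = here refl
  ... | no  u≢u  = contradiction refl u≢u
  paths-complete {suc k} {u} {w} (_∷_ {v = v} s γ) =
    ∈-concatMap⁺ (pathsVia k u w) (lose (successors-complete s) s∷γ∈)
    where
    s∷γ∈ : (s ∷ γ) ∈ pathsVia k u w v
    s∷γ∈ with step? u v
    ... | yes t rewrite step-irrelevant s t = ∈-map⁺ (t ∷_) (paths-complete γ)
    ... | no ¬s = contradiction s ¬s

  paths-unique : ∀ k u w → Unique (paths k u w)
  paths-unique zero u w with u ≟ₚ w
  ... | yes refl = [] ∷ []
  ... | no  _    = []
  paths-unique (suc k) u w =
    Unique.concat⁺ (All.map⁺ (universal via-unique (successors u)))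
                   (AllPairs.map⁺ (AllPairs.map via-disjoint (successors-unique u)))
    where
    via-unique : ∀ v → Unique (pathsVia k u w v)
    via-unique v with step? u v
    ... | yes s = Unique.map⁺ (λ { refl → refl }) (paths-unique k v w)
    ... | no  _ = []

    second : Path (suc k) u w → Point
    second (_∷_ {v = v} _ _) = v

    via-second : ∀ {v γ} → γ ∈ pathsVia k u w v → second γ ≡ v
    via-second {v} γ∈ with step? u v
    ... | yes s with ∈-map⁻ (s ∷_) γ∈
    ...   | _ , _ , refl = refl

    via-disjoint : ∀ {v v′} → v ≢ v′ →
                   Disjoint (pathsVia k u w v) (pathsVia k u w v′)
    via-disjoint v≢v′ (γ∈ , γ∈′) =
      v≢v′ (≡.trans (≡.sym (via-second γ∈)) (via-second γ∈′))

  𝒫 : (n : ℕ) (i j : ℤ) → List (Path n (0 , i) (n , j))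
  𝒫 n i j = paths n (0 , i) (n , j)

  𝒟 : (n i j : ℕ) → List (Path n (0 , + i) (n , + j))
  𝒟 n i j = filter (noPointBelow? (+ 0)) (𝒫 n (+ i) (+ j))

  𝒟⁽¹⁾ : (n i j : ℕ) → List (Path n (0 , + suc i) (n , + suc j))
  𝒟⁽¹⁾ n i j = filter (noPointBelow? (+ 1)) (𝒟 n (suc i) (suc j))

------------------------------------------------------------------------
-- Sums, formal series and spans over the scalars

module Scalars {c ℓ} (R : ConjugationRing c ℓ) where

  open ConjugationRing R renaming (_+_ to _+ᴿ_; _*_ to _*ᴿ_; refl to ≈-refl)

  ∑ : ∀ {a} {A : Set a} → List A → (A → Carrier) → Carrier
  ∑ xs f = foldr (λ x s → f x +ᴿ s) 0# xs

  -- Formal Laurent series at infinity: coeff k is the coefficient of z^k, and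
  -- only finitely many positive powers of z occur.
  record LaurentSeries : Set (c ⊔ ℓ) where
    field
      coeff   : ℤ → Carrier
      bounded : ∃ λ N → ∀ k → N < k → coeff k ≈ 0#

  open LaurentSeries public

  infix 4 _≋_
  _≋_ : LaurentSeries → LaurentSeries → Set ℓ
  f ≋ g = ∀ k → coeff f k ≈ coeff g k

  -- ∑_{n ≥ 0} c n / z^{n+1}; note that -[1+ n ] is the integer -(n+1).
  series : (ℕ → Carrier) → LaurentSeries
  series s .coeff (+ _)    = 0#
  series s .coeff -[1+ n ] = s n
  series s .bounded        = -[1+ 0 ] , λ { (+ _) _ → ≈-refl ; -[1+ _ ] (ℤ.-<- ()) }

  -- Finite linear combinations of vectors e_i (i ∈ I).
  module Span {I : Set} (_≟_ : DecidableEquality I) where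

    -- The list (c₁ , i₁) ∷ (c₂ , i₂) ∷ … stands for c₁ e_{i₁} + c₂ e_{i₂} + …;
    -- indices may repeat, and vectors are compared by _≈ᵥ_.
    Vector : Set c
    Vector = List (Carrier × I)

    e : I → Vector
    e i = [ 1# , i ]

    infixl 6 _⊕_
    _⊕_ : Vector → Vector → Vector
    _⊕_ = _++_

    infixr 7 _•_
    _•_ : Carrier → Vector → Vector
    x • v = map (λ (c , i) → x *ᴿ c , i) v

    ⨁ : List ℕ → (ℕ → Vector) → Vector
    ⨁ ms f = concatMap f ms

    -- The linear functional with e_i ↦ g i.
    functional : (I → Carrier) → Vector → Carrier
    functional g v = ∑ v (λ (c , i) → c *ᴿ g i)

    δ : I → I → Carrier
    δ i j with i ≟ j
    ... | yes _ = 1#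
    ... | no  _ = 0#

    component : Vector → I → Carrier
    component v i = functional (δ i) v

    infix 4 _≈ᵥ_
    _≈ᵥ_ : Vector → Vector → Set ℓ
    u ≈ᵥ v = ∀ i → component u i ≈ component v i

    -- ∑_i u_i conj(v_i)
    ⟨_,_⟩ : Vector → Vector → Carrier
    ⟨ u , v ⟩ = functional (conj ∘ component v) u

    -- The linear operator with e_i ↦ f i.
    linear : (I → Vector) → Vector → Vector
    linear f v = concatMap (λ (c , i) → c • f i) v

    -- Functionals, operators and the inner product respect _≈ᵥ_.

    open import Relation.Binary.Reasoning.Setoid setoid

    private
      ∑-cong : ∀ {a} {A : Set a} (xs : List A) {f g : A → Carrier} →
               (∀ x → f x ≈ g x) → ∑ xs f ≈ ∑ xs g
      ∑-cong []       f≈g = ≈-refl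
      ∑-cong (x ∷ xs) f≈g = +-cong (f≈g x) (∑-cong xs f≈g)

      ∑-zero : ∀ {a} {A : Set a} (xs : List A) {f : A → Carrier} →
               (∀ x → x ∈ xs → f x ≈ 0#) → ∑ xs f ≈ 0#
      ∑-zero []       f≈0 = ≈-refl
      ∑-zero (x ∷ xs) f≈0 =
        trans (+-cong (f≈0 x (here refl)) (∑-zero xs (λ y → f≈0 y ∘ there)))
              (+-identityˡ 0#)

      +-interchange : ∀ w x y z → (w +ᴿ x) +ᴿ (y +ᴿ z) ≈ (w +ᴿ y) +ᴿ (x +ᴿ z)
      +-interchange w x y z = begin
        (w +ᴿ x) +ᴿ (y +ᴿ z) ≈⟨ +-assoc w x _ ⟩
        w +ᴿ (x +ᴿ (y +ᴿ z)) ≈⟨ +-congˡ (sym (+-assoc x y z)) ⟩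
        w +ᴿ ((x +ᴿ y) +ᴿ z) ≈⟨ +-congˡ (+-congʳ (+-comm x y)) ⟩
        w +ᴿ ((y +ᴿ x) +ᴿ z) ≈⟨ +-congˡ (+-assoc y x z) ⟩
        w +ᴿ (y +ᴿ (x +ᴿ z)) ≈⟨ sym (+-assoc w y _) ⟩
        (w +ᴿ y) +ᴿ (x +ᴿ z) ∎

      ∑-+ : ∀ {a} {A : Set a} (xs : List A) (f g : A → Carrier) →
            ∑ xs (λ x → f x +ᴿ g x) ≈ ∑ xs f +ᴿ ∑ xs g
      ∑-+ []       f g = sym (+-identityˡ 0#)
      ∑-+ (x ∷ xs) f g = trans (+-congˡ (∑-+ xs f g)) (+-interchange _ _ _ _)

      ∑-* : ∀ {a} {A : Set a} y (xs : List A) (f : A → Carrier) →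
            ∑ xs (λ x → y *ᴿ f x) ≈ y *ᴿ ∑ xs f
      ∑-* y []       f = sym (zeroʳ y)
      ∑-* y (x ∷ xs) f = trans (+-congˡ (∑-* y xs f)) (sym (distribˡ y _ _))

      δ-same : ∀ i → δ i i ≈ 1#
      δ-same i with i ≟ i
      ... | yes _  = ≈-refl
      ... | no i≢i = contradiction refl i≢i

      δ-distinct : ∀ {i j} → i ≢ j → δ i j ≈ 0#
      δ-distinct {i} {j} i≢j with i ≟ j
      ... | yes i≡j = contradiction i≡j i≢j
      ... | no _    = ≈-refl

      ∑-δ : ∀ {S i} (g : I → Carrier) → Unique S → i ∈ S →
            ∑ S (λ j → δ j i *ᴿ g j) ≈ g i
      ∑-δ {j ∷ S} {i} g (j∉S ∷ _) (here refl) = begin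
        δ i i *ᴿ g i +ᴿ ∑ S (λ j → δ j i *ᴿ g j)
          ≈⟨ +-cong (trans (*-congʳ (δ-same i)) (*-identityˡ _))
               (∑-zero S λ k k∈S → trans (*-congʳ (δ-distinct (≢-of k∈S))) (zeroˡ _)) ⟩
        g i +ᴿ 0#  ≈⟨ +-identityʳ _ ⟩
        g i        ∎
        where
        ≢-of : ∀ {k} → k ∈ S → k ≢ i
        ≢-of k∈S refl = lookup j∉S k∈S refl
      ∑-δ {j ∷ S} {i} g (j∉S ∷ uS) (there i∈S) = begin
        δ j i *ᴿ g j +ᴿ ∑ S (λ j → δ j i *ᴿ g j)
          ≈⟨ +-cong (trans (*-congʳ (δ-distinct (lookup j∉S i∈S)))
                           (zeroˡ _))
                    (∑-δ g uS i∈S) ⟩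
        0# +ᴿ g i  ≈⟨ +-identityˡ _ ⟩
        g i        ∎

      functional-component : ∀ {S} (g : I → Carrier) v → Unique S →
                             (∀ {i} → i ∈ map proj₂ v → i ∈ S) →
                             functional g v ≈ ∑ S (λ j → component v j *ᴿ g j)
      functional-component {S} g [] _ _ = sym (∑-zero S λ j _ → zeroˡ (g j))
      functional-component {S} g ((x , i) ∷ v) uS v⊆S = sym (begin
        ∑ S (λ j → (x *ᴿ δ j i +ᴿ component v j) *ᴿ g j)
          ≈⟨ ∑-cong S (λ j → trans (distribʳ (g j) _ _) (+-congʳ (*-assoc x _ _))) ⟩
        ∑ S (λ j → x *ᴿ (δ j i *ᴿ g j) +ᴿ component v j *ᴿ g j)
          ≈⟨ ∑-+ S _ _ ⟩
        ∑ S (λ j → x *ᴿ (δ j i *ᴿ g j)) +ᴿ ∑ S (λ j → component v j *ᴿ g j)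
          ≈⟨ +-cong (trans (∑-* x S _) (*-congˡ (∑-δ g uS (v⊆S (here refl)))))
                    (sym (functional-component g v uS (v⊆S ∘ there))) ⟩
        x *ᴿ g i +ᴿ functional g v ∎)

    functional-cong : ∀ (g : I → Carrier) {u v} → u ≈ᵥ v → functional g u ≈ functional g v
    functional-cong g {u} {v} u≈v = begin
      functional g u                     ≈⟨ functional-component g u S! (∈-deduplicate⁺ _≟_ ∘ ∈-++⁺ˡ) ⟩
      ∑ S (λ j → component u j *ᴿ g j)   ≈⟨ ∑-cong S (λ j → *-congʳ (u≈v j)) ⟩
      ∑ S (λ j → component v j *ᴿ g j)   ≈⟨ sym (functional-component g v S!
                                              (∈-deduplicate⁺ _≟_ ∘ ∈-++⁺ʳ (map proj₂ u))) ⟩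
      functional g v                     ∎
      where
      S : List I
      S = deduplicate _≟_ (map proj₂ u ++ map proj₂ v)
      S! : Unique S
      S! = UniqueDec.deduplicate-! _≟_ (map proj₂ u ++ map proj₂ v)

    functional-⊕ : ∀ (g : I → Carrier) u v →
                   functional g (u ⊕ v) ≈ functional g u +ᴿ functional g v
    functional-⊕ g []      v = sym (+-identityˡ _)
    functional-⊕ g (_ ∷ u) v = trans (+-congˡ (functional-⊕ g u v)) (sym (+-assoc _ _ _))

    functional-• : ∀ (g : I → Carrier) x v → functional g (x • v) ≈ x *ᴿ functional g v
    functional-• g x []            = sym (zeroʳ x)
    functional-• g x ((y , i) ∷ v) =
      trans (+-cong (*-assoc x y (g i)) (functional-• g x v)) (sym (distribˡ x _ _))

    functional-linear : ∀ (g : I → Carrier) f v →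
                        functional g (linear f v) ≈ functional (functional g ∘ f) v
    functional-linear g f []            = ≈-refl
    functional-linear g f ((x , i) ∷ v) =
      trans (functional-⊕ g (x • f i) (linear f v))
            (+-cong (functional-• g x (f i)) (functional-linear g f v))

    linear-cong : ∀ f {u v} → u ≈ᵥ v → linear f u ≈ᵥ linear f v
    linear-cong f {u} {v} u≈v i = begin
      functional (δ i) (linear f u)       ≈⟨ functional-linear (δ i) f u ⟩
      functional (functional (δ i) ∘ f) u ≈⟨ functional-cong (functional (δ i) ∘ f) {u} {v} u≈v ⟩
      functional (functional (δ i) ∘ f) v ≈⟨ sym (functional-linear (δ i) f v) ⟩
      functional (δ i) (linear f v)       ∎

    ⟨,⟩-cong : ∀ {u u′ v v′} → u ≈ᵥ u′ → v ≈ᵥ v′ → ⟨ u , v ⟩ ≈ ⟨ u′ , v′ ⟩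
    ⟨,⟩-cong {u} {u′} {v} {v′} u≈u′ v≈v′ = begin
      functional (conj ∘ component v) u   ≈⟨ functional-cong (conj ∘ component v) {u} {u′} u≈u′ ⟩
      functional (conj ∘ component v) u′  ≈⟨ ∑-cong u′ (λ (_ , i) → *-congˡ (⟦⟧-cong (v≈v′ i))) ⟩
      functional (conj ∘ component v′) u′ ∎
      where open RingMorphisms.IsRingHomomorphism conj-homomorphism using (⟦⟧-cong)

------------------------------------------------------------------------
-- Weighted paths and resolvent functions

-- a k n stands for a_n^{(k)}; only the values with -p ≤ k ≤ q are ever used.
module Model {c ℓ} (R : ConjugationRing c ℓ) (p q : ℕ)
             (a : ℤ → ℤ → ConjugationRing.Carrier R) where

  open ConjugationRing R using (Carrier; 1#) renaming (_*_ to _*ᴿ_)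
  open Scalars R
  open LatticePaths p q

  -- The weight of a step from height m to height m + d.
  incrementWeight : (m d : ℤ) → Carrier
  incrementWeight m d@(+ _)      = a d m
  incrementWeight m d@(-[1+ _ ]) = a d (m +ℤ d)

  stepWeight : ∀ {u v} → Step u v → Carrier
  stepWeight (step {m = m} {m′ = m′} _ _) = incrementWeight m (m′ -ℤ m)

  weight : ∀ {k u v} → Path k u v → Carrier
  weight []      = 1#
  weight (s ∷ γ) = stepWeight s *ᴿ weight γ

  A[_,_,_] : (n i j : ℕ) → Carrier
  A[ n , i , j ] = ∑ (𝒟 n i j) weight

  A⁽¹⁾[_,_,_] : (n i j : ℕ) → Carrier
  A⁽¹⁾[ n , i , j ] = ∑ (𝒟⁽¹⁾ n i j) weight

  W[_,_,_] : (n : ℕ) (i j : ℤ) → Carrier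
  W[ n , i , j ] = ∑ (𝒫 n i j) weight

  A : (i j : ℕ) → LaurentSeries
  A i j = series λ n → A[ n , i , j ]

  A⁽¹⁾ : (i j : ℕ) → LaurentSeries
  A⁽¹⁾ i j = series λ n → A⁽¹⁾[ n , i , j ]

  W : (i j : ℤ) → LaurentSeries
  W i j = series λ n → W[ n , i , j ]

  module ℰ  = Span ℤ._≟_
  module ℰ₀ = Span ℕ._≟_

  -- The lists 1, …, k and 0, …, k.
  1… 0… : ℕ → List ℕ
  1… k = map suc (upTo k)
  0… k = upTo (suc k)

  𝒲 : ℰ.Vector → ℰ.Vector
  𝒲 = linear λ n →
      ⨁ (1… q) (λ m → a (+ m) (n -ℤ + m) • e (n -ℤ + m))
    ⊕ ⨁ (0… p) (λ m → a (-ℤ (+ m)) n • e (n +ℤ + m))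
    where open ℰ

  -- In the first sums of ℋ and ℋ₁ one has m ≤ n, so n ∸ m is the true difference.
  ℋ : ℰ₀.Vector → ℰ₀.Vector
  ℋ = linear λ n →
      ⨁ (1… (n ⊓ q)) (λ m → a (+ m) (+ (n ∸ m)) • e (n ∸ m))
    ⊕ ⨁ (0… p) (λ m → a (-ℤ (+ m)) (+ n) • e (n + m))
    where open ℰ₀

  ℋ₁ : ℰ₀.Vector → ℰ₀.Vector
  ℋ₁ = linear λ n →
      ⨁ (1… (n ⊓ q)) (λ m → a (+ m) (+ (n ∸ m + 1)) • e (n ∸ m))
    ⊕ ⨁ (0… p) (λ m → a (-ℤ (+ m)) (+ (n + 1)) • e (n + m))
    where open ℰ₀

  ψ : (i j : ℤ) → LaurentSeries
  ψ i j = series λ n → ⟨ fold (e j) 𝒲 n , e i ⟩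
    where open ℰ

  φ : (i j : ℕ) → LaurentSeries
  φ i j = series λ n → ⟨ fold (e j) ℋ n , e i ⟩
    where open ℰ₀

  φ⁽¹⁾ : (i j : ℕ) → LaurentSeries
  φ⁽¹⁾ i j = series λ n → ⟨ fold (e j) ℋ₁ n , e i ⟩
    where open ℰ₀

{-# OPTIONS --safe #-}

-- Both sides satisfy the same recursion.  Write δ_m for the functional reading
-- off the coordinate at height m.  Composing δ_m with the operator yields
-- ∑_v w(m → v) δ_v, so the coefficients δ_m (T^n e_j) obey the recursion that
-- path sums obey when a path is decomposed by its first step.  For ℋ and ℋ₁ the
-- functionals δ_v with v below the boundary vanish, just as the corresponding
-- sums over restricted paths do.
module Submission where

open import Defs
open import Algebra.Bundles using (CommutativeMonoid)
open import Algebra.Morphism.Structures using (module RingMorphisms)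
open import Data.Bool using (true; false; if_then_else_)
open import Data.Integer using (ℤ; +_; -[1+_])
  renaming (_+_ to _+ℤ_; _-_ to _-ℤ_; -_ to -ℤ_; _≤_ to _≤ℤ_)
import Data.Integer as ℤ
import Data.Integer.Properties as ℤₚ
open import Data.Integer.Tactic.RingSolver using (solve-∀)
open import Data.List using (List; []; _∷_; _++_; map; concatMap; filter; upTo)
open import Data.List.Membership.Propositional using (_∈_)
open import Data.List.Membership.Propositional.Properties
  using (∈-map⁺; ∈-map⁻; ∈-upTo⁺; ∈-upTo⁻)
open import Data.List.Properties using (filter-all)
open import Data.List.Relation.Unary.All as All using (All; []; _∷_; all?; lookup; universal)
open import Data.List.Relation.Unary.AllPairs using (_∷_)
open import Data.List.Relation.Unary.Any using (here; there)
open import Data.List.Relation.Unary.Unique.Propositional using (Unique)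
import Data.List.Relation.Unary.Unique.Propositional.Properties as Unique
open import Data.Nat using (ℕ; zero; suc; _+_; _∸_; _⊓_; _≤_; s≤s; z≤n)
import Data.Nat as ℕ
open import Data.Nat.GeneralisedArithmetic using (fold)
import Data.Nat.Properties as ℕₚ
open import Data.Product using (_×_; _,_; proj₁; proj₂)
open import Data.Unit using (⊤; tt)
open import Function using (_∘_; id)
open import Level using (Level)
open import Relation.Binary using (DecidableEquality)
open import Relation.Binary.PropositionalEquality as ≡ using (_≡_; _≢_; refl)
open import Relation.Nullary using (Dec; yes; no; does; ¬_; contradiction)
open import Relation.Unary using (Pred; Decidable)

-- Nested filters and integer arithmetic.

filter-filter : ∀ {a p q} {A : Set a} {P : Pred A p} {Q : Pred A q}
                (P? : Decidable P) (Q? : Decidable Q) → (∀ {x} → Q x → P x) →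
                ∀ xs → filter Q? (filter P? xs) ≡ filter Q? xs
filter-filter P? Q? Q⇒P [] = refl
filter-filter P? Q? Q⇒P (x ∷ xs) with P? x
... | yes _ with Q? x
...   | yes _ = ≡.cong (x ∷_) (filter-filter P? Q? Q⇒P xs)
...   | no  _ = filter-filter P? Q? Q⇒P xs
filter-filter P? Q? Q⇒P (x ∷ xs) | no ¬px with Q? x
...   | yes qx = contradiction (Q⇒P qx) ¬px
...   | no  _  = filter-filter P? Q? Q⇒P xs

i-j≡k⇒i-k≡j : ∀ i j k → i -ℤ j ≡ k → i -ℤ k ≡ j
i-j≡k⇒i-k≡j i j .(i -ℤ j) refl = cancel i j
  where
  cancel : ∀ i j → i -ℤ (i -ℤ j) ≡ j
  cancel = solve-∀

i-[i+j]≡-j : ∀ i j → i -ℤ (i +ℤ j) ≡ -ℤ j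
i-[i+j]≡-j = solve-∀

∸-height : ∀ h {t l} → t ≤ l → + (h + (l ∸ t)) ≡ + (h + l) -ℤ + t
∸-height h {t} {l} t≤l = begin
  + (h + (l ∸ t))  ≡⟨ ≡.cong +_ (≡.sym (ℕₚ.+-∸-assoc h t≤l)) ⟩
  + ((h + l) ∸ t)  ≡⟨ ≡.sym (ℤₚ.⊖-≥ (ℕₚ.≤-trans t≤l (ℕₚ.m≤n+m l h))) ⟩
  (h + l) ℤ.⊖ t    ≡⟨ ≡.sym (ℤₚ.m-n≡m⊖n (h + l) t) ⟩
  + (h + l) -ℤ + t ∎
  where open ≡.≡-Reasoning

-- The hypothesis rearranges to `h + t ≤ h + l`, from which `h` cancels. This is why cutting the
-- index range off at `l` loses no term on or above the line at height `h`.
above⇒≤ : ∀ h {t l} → + h ≤ℤ + (h + l) -ℤ + t → t ≤ l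
above⇒≤ h {t} {l} h≤ = ℕₚ.+-cancelˡ-≤ h t l (ℤₚ.drop‿+≤+
  (≡.subst (+ (h + t) ≤ℤ_) ([i-j]+j≡i (+ (h + l)) (+ t)) (ℤₚ.+-monoˡ-≤ (+ t) h≤)))
  where
  [i-j]+j≡i : ∀ i j → (i -ℤ j) +ℤ j ≡ i
  [i-j]+j≡i = solve-∀

-- Finite sums and linear functionals over the scalars.

module Sums {c ℓ} (R : ConjugationRing c ℓ) where

  open ConjugationRing R renaming (_+_ to _+ᴿ_; _*_ to _*ᴿ_; refl to ≈-refl) hiding (zero)
  open Scalars R
  open import Relation.Binary.Reasoning.Setoid setoid
  open import Algebra.Properties.CommutativeSemigroup
    (CommutativeMonoid.commutativeSemigroup +-commutativeMonoid)
    using () renaming (interchange to +-interchange)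
  open import Algebra.Properties.CommutativeSemigroup
    (CommutativeMonoid.commutativeSemigroup *-commutativeMonoid)
    using () renaming (x∙yz≈y∙xz to *-swapˡ)

  private variable
    α β : Level
    X : Set α
    Y : Set β

  ∑-cong : ∀ (xs : List X) {f g : X → Carrier} → (∀ x → f x ≈ g x) → ∑ xs f ≈ ∑ xs g
  ∑-cong []       f≈g = ≈-refl
  ∑-cong (x ∷ xs) f≈g = +-cong (f≈g x) (∑-cong xs f≈g)

  ∑-zero : ∀ (xs : List X) {f : X → Carrier} → (∀ x → x ∈ xs → f x ≈ 0#) → ∑ xs f ≈ 0#
  ∑-zero []       f≈0 = ≈-refl
  ∑-zero (x ∷ xs) f≈0 =
    trans (+-cong (f≈0 x (here refl)) (∑-zero xs (λ y → f≈0 y ∘ there))) (+-identityˡ 0#)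

  ∑-single : ∀ {xs : List X} {x} {f : X → Carrier} → Unique xs → x ∈ xs →
             (∀ y → y ∈ xs → y ≢ x → f y ≈ 0#) → ∑ xs f ≈ f x
  ∑-single {xs = y ∷ xs} (y∉xs ∷ _) (here refl) f≈0 =
    trans (+-congˡ (∑-zero xs λ z z∈xs →
                     f≈0 z (there z∈xs) (λ { refl → lookup y∉xs z∈xs refl })))
          (+-identityʳ _)
  ∑-single {xs = y ∷ xs} (y∉xs ∷ xs!) (there x∈xs) f≈0 =
    trans (+-cong (f≈0 y (here refl) (lookup y∉xs x∈xs))
                  (∑-single xs! x∈xs (λ z → f≈0 z ∘ there)))
          (+-identityˡ _)

  ∑-+ : ∀ (xs : List X) (f g : X → Carrier) → ∑ xs (λ x → f x +ᴿ g x) ≈ ∑ xs f +ᴿ ∑ xs g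
  ∑-+ []       f g = sym (+-identityˡ 0#)
  ∑-+ (x ∷ xs) f g = trans (+-congˡ (∑-+ xs f g)) (+-interchange _ _ _ _)

  ∑-* : ∀ y (xs : List X) (f : X → Carrier) → ∑ xs (λ x → y *ᴿ f x) ≈ y *ᴿ ∑ xs f
  ∑-* y []       f = sym (zeroʳ y)
  ∑-* y (x ∷ xs) f = trans (+-congˡ (∑-* y xs f)) (sym (distribˡ y _ _))

  ∑-++ : ∀ (xs ys : List X) (f : X → Carrier) → ∑ (xs ++ ys) f ≈ ∑ xs f +ᴿ ∑ ys f
  ∑-++ []       ys f = sym (+-identityˡ _)
  ∑-++ (x ∷ xs) ys f = trans (+-congˡ (∑-++ xs ys f)) (sym (+-assoc _ _ _))

  ∑-concatMap : ∀ (g : X → List Y) xs (f : Y → Carrier) →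
                ∑ (concatMap g xs) f ≈ ∑ xs (λ x → ∑ (g x) f)
  ∑-concatMap g []       f = ≈-refl
  ∑-concatMap g (x ∷ xs) f = trans (∑-++ (g x) _ f) (+-congˡ (∑-concatMap g xs f))

  ∑-map : ∀ (g : X → Y) xs (f : Y → Carrier) → ∑ (map g xs) f ≈ ∑ xs (f ∘ g)
  ∑-map g []       f = ≈-refl
  ∑-map g (x ∷ xs) f = +-congˡ (∑-map g xs f)

  ∑-filter : ∀ {p} {P : Pred X p} (P? : Decidable P) xs (f : X → Carrier) →
             ∑ (filter P? xs) f ≈ ∑ xs (λ x → if does (P? x) then f x else 0#)
  ∑-filter P? []       f = ≈-refl
  ∑-filter P? (x ∷ xs) f with does (P? x)
  ... | true  = +-congˡ (∑-filter P? xs f)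
  ... | false = trans (∑-filter P? xs f) (sym (+-identityˡ _))

  module Functionals {I : Set} (_≟_ : DecidableEquality I) where
    open Span _≟_

    δ-same : ∀ i → δ i i ≈ 1#
    δ-same i with i ≟ i
    ... | yes _  = ≈-refl
    ... | no i≢i = contradiction refl i≢i

    δ-distinct : ∀ {i j} → i ≢ j → δ i j ≈ 0#
    δ-distinct {i} {j} i≢j with i ≟ j
    ... | yes i≡j = contradiction i≡j i≢j
    ... | no _    = ≈-refl

    functional-congˡ : ∀ {g h} v → (∀ i → g i ≈ h i) → functional g v ≈ functional h v
    functional-congˡ v g≈h = ∑-cong v λ (_ , i) → *-congˡ (g≈h i)

    functional-zero : ∀ {g} v → (∀ i → g i ≈ 0#) → functional g v ≈ 0#
    functional-zero v g≈0 = ∑-zero v λ (_ , i) _ → trans (*-congˡ (g≈0 i)) (zeroʳ _)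

    -- Interchange of two finite sums, with commutativity moving `k x` past the coefficients of the
    -- vector. It later splits a functional according to the first step of a path.
    functional-∑ : ∀ (xs : List X) (k : X → Carrier) (g : X → I → Carrier) v →
                   functional (λ i → ∑ xs (λ x → k x *ᴿ g x i)) v ≈
                   ∑ xs (λ x → k x *ᴿ functional (g x) v)
    functional-∑ xs k g []            = sym (∑-zero xs λ _ _ → zeroʳ _)
    functional-∑ xs k g ((y , i) ∷ v) = begin
      y *ᴿ ∑ xs (λ x → k x *ᴿ g x i) +ᴿ functional (λ i → ∑ xs (λ x → k x *ᴿ g x i)) v
        ≈⟨ +-cong (sym (∑-* y xs _)) (functional-∑ xs k g v) ⟩
      ∑ xs (λ x → y *ᴿ (k x *ᴿ g x i)) +ᴿ ∑ xs (λ x → k x *ᴿ functional (g x) v)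
        ≈⟨ sym (∑-+ xs _ _) ⟩
      ∑ xs (λ x → y *ᴿ (k x *ᴿ g x i) +ᴿ k x *ᴿ functional (g x) v)
        ≈⟨ ∑-cong xs (λ x → trans (+-congʳ (*-swapˡ y (k x) (g x i))) (sym (distribˡ (k x) _ _))) ⟩
      ∑ xs (λ x → k x *ᴿ (y *ᴿ g x i +ᴿ functional (g x) v)) ∎

    functional-⨁ : ∀ g ts (k : ℕ → Carrier) (x : ℕ → I) →
                   functional g (⨁ ts (λ t → k t • e (x t))) ≈ ∑ ts (λ t → k t *ᴿ g (x t))
    functional-⨁ g ts k x = trans (∑-concatMap _ ts _)
      (∑-cong ts λ t → trans (+-identityʳ _) (*-congʳ (*-identityʳ _)))

    -- The coordinates of a basis vector are 0 and 1, which the homomorphism `conj` fixes, so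
    -- conjugation disappears from the inner product with `e i`.
    conj-component-e : ∀ i k → conj (component (e i) k) ≈ δ k i
    conj-component-e i k = trans
      (⟦⟧-cong (trans (+-identityʳ _) (*-identityˡ _))) conj-δ
      where
      open RingMorphisms.IsRingHomomorphism conj-homomorphism using (⟦⟧-cong; 0#-homo; 1#-homo)
      conj-δ : conj (δ k i) ≈ δ k i
      conj-δ with k ≟ i
      ... | yes _ = 1#-homo
      ... | no  _ = 0#-homo

-- Step weights as matrix entries of the operators.

module Resolvents {c ℓ} (R : ConjugationRing c ℓ) (p q : ℕ)
                  (a : ℤ → ℤ → ConjugationRing.Carrier R) where

  open ConjugationRing R renaming (_+_ to _+ᴿ_; _*_ to _*ᴿ_; refl to ≈-refl) hiding (zero)
  open Scalars R
  open Sums R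
  open LatticePaths p q
  open Model R p q a
  open ℰ using () renaming (δ to δℤ)
  open Functionals ℤ._≟_ using (δ-same; δ-distinct)
  open import Relation.Binary.Reasoning.Setoid setoid

  -- The value 0 in the absence of a step makes this total, hence comparable with matrix entries at
  -- arbitrary heights. The directions are opposite: the operator carries `e n` to height `m`, while
  -- the step runs from `m` to `n`.
  transition : Point → Point → Carrier
  transition u v with step? u v
  ... | yes s = stepWeight s
  ... | no  _ = 0#

  -- All successors share the abscissa `suc s`, so the delta leaves at most the one at height `n`;
  -- if no step leads there, both sides vanish. This writes a matrix entry as a combination of
  -- coordinate functionals, one per first step.
  ∑-successors : ∀ s m n → ∑ (successors (s , m)) (λ v → transition (s , m) v *ᴿ δℤ (proj₂ v) n)
                         ≈ transition (s , m) (suc s , n)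
  ∑-successors s m n with step? (s , m) (suc s , n) in eq
  ... | yes σ = trans
    (∑-single (successors-unique (s , m)) (successors-complete σ) λ v v∈ v≢ →
      trans (*-congˡ (δ-distinct {proj₂ v} {n} (λ { refl → v≢ (same-abscissa v∈) }))) (zeroʳ _))
    (trans (*-congˡ (δ-same n)) (trans (*-identityʳ _) at-end))
    where
    same-abscissa : ∀ {v} → v ∈ successors (s , m) → v ≡ (suc s , proj₂ v)
    same-abscissa v∈ with ∈-map⁻ _ v∈
    ... | _ , _ , refl = refl
    at-end : transition (s , m) (suc s , n) ≈ stepWeight σ
    at-end rewrite eq = ≈-refl
  ... | no ¬σ = ∑-zero (successors (s , m)) vanish
    where
    vanish : ∀ v → v ∈ successors (s , m) → transition (s , m) v *ᴿ δℤ (proj₂ v) n ≈ 0#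
    vanish v v∈ with ∈-map⁻ _ v∈
    vanish (_ , y) v∈ | _ , _ , refl with y ℤ.≟ n
    ... | no  _    = zeroʳ _
    ... | yes refl rewrite eq = zeroˡ _

  transition-step : ∀ s m n → Step (s , m) (suc s , n) →
                    transition (s , m) (suc s , n) ≈ incrementWeight m (n -ℤ m)
  transition-step s m n σ with step? (s , m) (suc s , n)
  ... | yes (step _ _) = ≈-refl
  ... | no  ¬σ         = contradiction σ ¬σ

  transition-none : ∀ s m n → ¬ Step (s , m) (suc s , n) →
                    transition (s , m) (suc s , n) ≈ 0#
  transition-none s m n ¬σ with step? (s , m) (suc s , n)
  ... | yes σ = contradiction σ ¬σ
  ... | no  _ = ≈-refl

  δ-term-zero : ∀ {x m n} → m ≢ n → x *ᴿ δℤ m n ≈ 0#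
  δ-term-zero {m = m} {n} m≢n = trans (*-congˡ (δ-distinct {m} {n} m≢n)) (zeroʳ _)

  δ-term-one : ∀ {x m n} → m ≡ n → x *ᴿ δℤ m n ≈ x
  δ-term-one {m = m} refl = trans (*-congˡ (δ-same m)) (*-identityʳ _)

  -- ts is 1, …, q for 𝒲 and 1, …, min(l, q) for ℋ and ℋ₁ at e_l; the indices lost
  -- to the minimum would lead below the boundary, so complete holds for every
  -- admissible height m.
  module _ {m n : ℤ} {ts} (k : ℕ → Carrier) (x : ℕ → ℤ) (ts! : Unique ts)
    (sound : ∀ t → t ∈ ts → 1 ≤ t × t ≤ q × x t ≡ n -ℤ + t × k t ≡ a (+ t) (n -ℤ + t))
    (complete : ∀ t → 1 ≤ t → t ≤ q → n -ℤ + t ≡ m → t ∈ ts) where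

    private
      -- Coordinates at height `m` of the terms of the two sums in the image of the basis vector at
      -- height `n`. The names follow the path: a term that lowers the index by `t` matches a step
      -- rising by `t`.
      rising falling : ℕ → Carrier
      rising  t = k t *ᴿ δℤ m (x t)
      falling t = a (-ℤ (+ t)) n *ᴿ δℤ m (n +ℤ + t)

      rising-hit : ∀ {t} → t ∈ ts → m ≡ x t → n -ℤ m ≡ + t
      rising-hit {t} t∈ m≡ with _ , _ , x≡ , _ ← sound t t∈ =
        i-j≡k⇒i-k≡j n (+ t) m (≡.sym (≡.trans m≡ x≡))

      falling-hit : ∀ t → m ≡ n +ℤ + t → n -ℤ m ≡ -ℤ (+ t)
      falling-hit t refl = i-[i+j]≡-j n (+ t)

    -- Falling terms have the wrong sign, and among the rising ones only the index `suc d` lands on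
    -- `m`.
    transition-up : ∀ s d → n -ℤ m ≡ + suc d →
      ∑ ts rising +ᴿ ∑ (0… p) falling ≈ transition (s , m) (suc s , n)
    transition-up s d n-m≡ = trans (+-congˡ no-falling) (trans (+-identityʳ _) rise)
      where
      no-falling : ∑ (0… p) falling ≈ 0#
      no-falling = ∑-zero (0… p) λ t _ → δ-term-zero (absurd t)
        where
        absurd : ∀ t → m ≢ n +ℤ + t
        -- Splitting on `t` lets `-ℤ (+ t)` reduce, after which its sign clashes with that of
        -- `+ suc d`.
        absurd zero    m≡ with () ← ≡.trans (≡.sym n-m≡) (falling-hit zero m≡)
        absurd (suc t) m≡ with () ← ≡.trans (≡.sym n-m≡) (falling-hit (suc t) m≡)

      hit-at : ∀ {t} → t ∈ ts → m ≡ x t → t ≡ suc d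
      hit-at t∈ m≡ = ℤₚ.+-injective (≡.trans (≡.sym (rising-hit t∈ m≡)) n-m≡)

      rise : ∑ ts rising ≈ transition (s , m) (suc s , n)
      rise with suc d ℕ.≤? q
      -- The increment exceeds `q`: no index in `ts` attains it, and no step exists either.
      ... | no d≮q = trans
        (∑-zero ts λ t t∈ → δ-term-zero λ m≡ →
          d≮q (≡.subst (_≤ q) (hit-at t∈ m≡) (proj₁ (proj₂ (sound t t∈)))))
        (sym (transition-none s m n λ { (step _ r) → d≮q (ℤₚ.drop‿+≤+ (≡.subst (_≤ℤ + q) n-m≡ r)) }))
      ... | yes d<q = begin
        ∑ ts rising                   ≈⟨ ∑-single ts! d∈ (λ t t∈ t≢ → δ-term-zero (t≢ ∘ hit-at t∈)) ⟩
        k (suc d) *ᴿ δℤ m (x (suc d)) ≈⟨ δ-term-one (≡.trans (≡.sym n-d≡m) (≡.sym x≡)) ⟩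
        k (suc d)                     ≡⟨ ≡.trans k≡ (≡.cong (a (+ suc d)) n-d≡m) ⟩
        a (+ suc d) m                 ≡⟨ ≡.cong (incrementWeight m) (≡.sym n-m≡) ⟩
        incrementWeight m (n -ℤ m)    ≈⟨ sym (transition-step s m n (step lower upper)) ⟩
        transition (s , m) (suc s , n) ∎
        where
        n-d≡m : n -ℤ + suc d ≡ m
        n-d≡m = i-j≡k⇒i-k≡j n m (+ suc d) n-m≡
        d∈ : suc d ∈ ts
        d∈ = complete (suc d) (s≤s z≤n) d<q n-d≡m
        x≡ : x (suc d) ≡ n -ℤ + suc d
        x≡ = proj₁ (proj₂ (proj₂ (sound _ d∈)))
        k≡ : k (suc d) ≡ a (+ suc d) (n -ℤ + suc d)
        k≡ = proj₂ (proj₂ (proj₂ (sound _ d∈)))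
        lower : -ℤ (+ p) ≤ℤ n -ℤ m
        lower = ≡.subst (-ℤ (+ p) ≤ℤ_) (≡.sym n-m≡) (ℤₚ.≤-trans (ℤₚ.neg-≤-pos {p} {0}) (ℤ.+≤+ z≤n))
        upper : n -ℤ m ≤ℤ + q
        upper = ≡.subst (_≤ℤ + q) (≡.sym n-m≡) (ℤ.+≤+ d<q)

    -- Rising terms are excluded because their indices are at least 1. The level step `d = 0`
    -- belongs here, since the second sum starts at 0.
    transition-down : ∀ s d → n -ℤ m ≡ -ℤ (+ d) →
      ∑ ts rising +ᴿ ∑ (0… p) falling ≈ transition (s , m) (suc s , n)
    transition-down s d n-m≡ = trans (+-congʳ no-rising) (trans (+-identityˡ _) fall)
      where
      pos≢neg : ∀ {t} e → 1 ≤ t → + t ≢ -ℤ (+ e)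
      pos≢neg zero    (s≤s _) ()
      pos≢neg (suc e) (s≤s _) ()

      no-rising : ∑ ts rising ≈ 0#
      no-rising = ∑-zero ts λ t t∈ → δ-term-zero λ m≡ →
        pos≢neg d (proj₁ (sound t t∈)) (≡.trans (≡.sym (rising-hit t∈ m≡)) n-m≡)

      hit-at : ∀ {t} → m ≡ n +ℤ + t → t ≡ d
      hit-at {t} m≡ = ℤₚ.+-injective
        (ℤₚ.neg-injective (≡.trans (≡.sym (falling-hit t m≡)) n-m≡))

      m≡n+d : m ≡ n +ℤ + d
      m≡n+d = ≡.trans (≡.sym (i-j≡k⇒i-k≡j n m _ n-m≡))
                      (≡.cong (n +ℤ_) (ℤₚ.neg-involutive (+ d)))

      -- A descending step is weighted at its lower end, which is `n`. For `d = 0` the weight is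
      -- read at `m` instead, and the hypothesis gives `m ≡ n`.
      falling-weight : ∀ d {m n} → n -ℤ m ≡ -ℤ (+ d) → incrementWeight m (-ℤ (+ d)) ≡ a (-ℤ (+ d)) n
      falling-weight zero    {m} {n} e = ≡.cong (a (+ 0)) (≡.sym (ℤₚ.i-j≡0⇒i≡j n m e))
      falling-weight (suc d) {m} {n} e = ≡.cong (a -[1+ d ])
        (≡.trans (≡.cong (m +ℤ_) (≡.sym e)) (i+[j-i]≡j m n))
        where
        i+[j-i]≡j : ∀ i j → i +ℤ (j -ℤ i) ≡ j
        i+[j-i]≡j = solve-∀

      fall : ∑ (0… p) falling ≈ transition (s , m) (suc s , n)
      fall with d ℕ.≤? p
      ... | no d≰p = trans
        (∑-zero (0… p) λ t t∈ → δ-term-zero λ m≡ →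
          d≰p (≡.subst (_≤ p) (hit-at m≡) (ℕₚ.≤-pred (∈-upTo⁻ t∈))))
        (sym (transition-none s m n λ { (step l _) →
          d≰p (ℤₚ.drop‿+≤+ (ℤₚ.neg-cancel-≤ (≡.subst (-ℤ (+ p) ≤ℤ_) n-m≡ l))) }))
      ... | yes d≤p = begin
        ∑ (0… p) falling               ≈⟨ ∑-single (Unique.upTo⁺ (suc p)) (∈-upTo⁺ (s≤s d≤p))
                                            (λ t _ t≢ → δ-term-zero (t≢ ∘ hit-at)) ⟩
        falling d                      ≈⟨ δ-term-one m≡n+d ⟩
        a (-ℤ (+ d)) n                 ≡⟨ ≡.sym (falling-weight d n-m≡) ⟩
        incrementWeight m (-ℤ (+ d))   ≡⟨ ≡.cong (incrementWeight m) (≡.sym n-m≡) ⟩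
        incrementWeight m (n -ℤ m)     ≈⟨ sym (transition-step s m n (step lower upper)) ⟩
        transition (s , m) (suc s , n) ∎
        where
        lower : -ℤ (+ p) ≤ℤ n -ℤ m
        lower = ≡.subst (-ℤ (+ p) ≤ℤ_) (≡.sym n-m≡) (ℤₚ.neg-mono-≤ (ℤ.+≤+ d≤p))
        upper : n -ℤ m ≤ℤ + q
        upper = ≡.subst (_≤ℤ + q) (≡.sym n-m≡) (ℤₚ.neg-≤-pos {d} {q})

    transition-sum : ∀ s → ∑ ts rising +ᴿ ∑ (0… p) falling ≈ transition (s , m) (suc s , n)
    transition-sum s with n -ℤ m in eq
    ... | + zero    = transition-down s 0 eq
    ... | + suc d   = transition-up s d eq
    ... | -[1+ d ]  = transition-down s (suc d) eq

  -- Sums over paths whose heights all satisfy a predicate.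

  module RestrictedPaths (P : ℤ → Set) (P? : ∀ y → Dec (P y)) where

    stays? : ∀ {k u v} (γ : Path k u v) → Dec (All (P ∘ proj₂) (vertices γ))
    stays? γ = all? (P? ∘ proj₂) (vertices γ)

    -- Giving forbidden paths weight 0 keeps every sum over the full list `paths`, whose recursion
    -- on the first step then applies unchanged.
    restrictedWeight : ∀ {k u v} → Path k u v → Carrier
    restrictedWeight γ = if does (stays? γ) then weight γ else 0#

    total : ∀ k (u w : Point) → Carrier
    total k u w = ∑ (paths k u w) restrictedWeight

    ∑-filter-stays : ∀ k u w → ∑ (filter stays? (paths k u w)) weight ≈ total k u w
    ∑-filter-stays k u w = ∑-filter stays? (paths k u w) weight

    restrictedWeight-outside : ∀ {k u v} → ¬ P (proj₂ u) → (γ : Path k u v) → restrictedWeight γ ≈ 0#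
    restrictedWeight-outside ¬Pu γ with stays? γ
    restrictedWeight-outside ¬Pu []      | yes (Pu ∷ _) = contradiction Pu ¬Pu
    restrictedWeight-outside ¬Pu (_ ∷ γ) | yes (Pu ∷ _) = contradiction Pu ¬Pu
    restrictedWeight-outside ¬Pu γ       | no _         = ≈-refl

    total-outside : ∀ k u w → ¬ P (proj₂ u) → total k u w ≈ 0#
    total-outside k u w ¬Pu = ∑-zero (paths k u w) λ γ _ → restrictedWeight-outside ¬Pu γ

    -- A path of length zero exists only for `m ≡ n`, and `P n` ensures that it is not given weight
    -- 0.
    total-zero : ∀ s m n → P n → total 0 (s , m) (s , n) ≈ δℤ m n
    total-zero s m n Pn with (s , m) ≟ₚ (s , n)
    ... | no  ≢    = sym (δ-distinct {m} {n} λ { refl → ≢ refl })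
    ... | yes refl with P? m
    ...   | yes _  = trans (+-identityʳ _) (sym (δ-same m))
    ...   | no ¬Pm = contradiction Pn ¬Pm

    -- Once the initial point is admissible, the whole path is admissible exactly when its tail is.
    restrictedWeight-∷ : ∀ {k u v w} → P (proj₂ u) → (s : Step u v) (γ : Path k v w) →
                         restrictedWeight (s ∷ γ) ≈ stepWeight s *ᴿ restrictedWeight γ
    restrictedWeight-∷ {u = u} Pu s γ with P? (proj₂ u)
    ... | no ¬Pu = contradiction Pu ¬Pu
    ... | yes _ with does (stays? γ)
    ...   | true  = ≈-refl
    ...   | false = sym (zeroʳ _)

    -- Paths are grouped by their second vertex; where no step leads to it, the group is empty and
    -- `transition` is 0.
    total-suc : ∀ k u w → P (proj₂ u) →
                total (suc k) u w ≈ ∑ (successors u) (λ v → transition u v *ᴿ total k v w)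
    total-suc k u w Pu = trans (∑-concatMap (pathsVia k u w) (successors u) _)
                               (∑-cong (successors u) via)
      where
      via : ∀ v → ∑ (pathsVia k u w v) restrictedWeight ≈ transition u v *ᴿ total k v w
      via v with step? u v
      ... | no  _ = sym (zeroˡ _)
      ... | yes s = trans (∑-map (s ∷_) (paths k v w) _)
        (trans (∑-cong (paths k v w) (restrictedWeight-∷ Pu s)) (∑-* _ (paths k v w) _))

    -- Basis vectors are placed injectively at admissible heights. The matrix entries are prescribed
    -- only for admissible `m`; at other heights no basis vector occurs, so the coordinate
    -- functional vanishes.
    module Operator {I : Set} (_≟_ : DecidableEquality I)
      (height : I → ℤ) (height-injective : ∀ {i j} → height i ≡ height j → i ≡ j)
      (height-in : ∀ i → P (height i))
      (f : I → Span.Vector _≟_)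
      (f-transition : ∀ s m l → P m → Span.functional _≟_ (δℤ m ∘ height) (f l)
                                    ≈ transition (s , m) (suc s , height l))
      where

      open Span _≟_

      private module F = Functionals _≟_

      -- Induction on `n` with the final point fixed and the initial point free. The outermost
      -- application of the operator becomes the first step, which advances `s` by one and so
      -- preserves `n + s ≡ t`.
      functional-power : ∀ n {s t} m l → n + s ≡ t →
        functional (δℤ m ∘ height) (fold (e l) (linear f) n) ≈ total n (s , m) (t , height l)
      functional-power zero {s} m l refl = begin
        1# *ᴿ δℤ m (height l) +ᴿ 0#     ≈⟨ trans (+-identityʳ _) (*-identityˡ _) ⟩
        δℤ m (height l)                 ≈⟨ sym (total-zero s m (height l) (height-in l)) ⟩
        total 0 (s , m) (s , height l)  ∎
      functional-power (suc n) {s} {t} m l n+s≡t with P? m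
      ... | no ¬Pm = trans
        (F.functional-zero (fold (e l) (linear f) (suc n)) λ i →
          δ-distinct {m} {height i} λ { refl → ¬Pm (height-in i) })
        (sym (total-outside (suc n) (s , m) (t , height l) ¬Pm))
      ... | yes Pm = begin
        functional (δℤ m ∘ height) (linear f v)
          ≈⟨ functional-linear (δℤ m ∘ height) f v ⟩
        functional (functional (δℤ m ∘ height) ∘ f) v
          ≈⟨ F.functional-congˡ v (λ i → trans (f-transition s m i Pm)
                                             (sym (∑-successors s m (height i)))) ⟩
        functional (λ i → ∑ (successors u) (λ w → transition u w *ᴿ δℤ (proj₂ w) (height i))) v
          ≈⟨ F.functional-∑ (successors u) (transition u) (λ w → δℤ (proj₂ w) ∘ height) v ⟩
        ∑ (successors u) (λ w → transition u w *ᴿ functional (δℤ (proj₂ w) ∘ height) v)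
          -- Reindexing by offsets makes the abscissa of every successor definitionally `suc s`, the
          -- form that the induction hypothesis needs.
          ≈⟨ ∑-map _ (upTo (suc (p + q))) _ ⟩
        ∑ (upTo (suc (p + q))) (λ r → transition u (succ r) *ᴿ functional (δℤ (proj₂ (succ r)) ∘ height) v)
          ≈⟨ ∑-cong (upTo (suc (p + q))) (λ r → *-congˡ
               (functional-power n (proj₂ (succ r)) l (≡.trans (ℕₚ.+-suc n s) n+s≡t))) ⟩
        ∑ (upTo (suc (p + q))) (λ r → transition u (succ r) *ᴿ total n (succ r) (t , height l))
          ≈⟨ sym (∑-map succ (upTo (suc (p + q))) _) ⟩
        ∑ (successors u) (λ w → transition u w *ᴿ total n w (t , height l))
          ≈⟨ sym (total-suc n u (t , height l) Pm) ⟩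
        total (suc n) u (t , height l) ∎
        where
        u : Point
        u = s , m
        v : Vector
        v = fold (e l) (linear f) n
        succ : ℕ → Point
        succ r = suc s , (m -ℤ + p) +ℤ + r

      -- Pairing with `e i` reads off the coordinate `i`. Injectivity of `height` identifies it with
      -- the coordinate at height `height i`, so the paths start at abscissa 0 and that height.
      inner-power : ∀ n i j → ⟨ fold (e j) (linear f) n , e i ⟩
                            ≈ total n (0 , height i) (n , height j)
      inner-power n i j = trans
        (F.functional-congˡ (fold (e j) (linear f) n) λ k →
          trans (F.conj-component-e i k) (δ-height k))
        (functional-power n (height i) j (ℕₚ.+-identityʳ n))
        where
        δ-height : ∀ k → δ k i ≈ δℤ (height i) (height k)
        δ-height k with k ≟ i
        ... | yes refl = sym (δ-same (height i))
        ... | no  k≢i  = sym (δ-distinct {height i} {height k} (k≢i ∘ ≡.sym ∘ height-injective))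

  -- The three operators as instances.

  ∈-1…⁺ : ∀ {k t} → 1 ≤ t → t ≤ k → t ∈ 1… k
  ∈-1…⁺ (s≤s _) t≤k = ∈-map⁺ suc (∈-upTo⁺ t≤k)

  ∈-1…⁻ : ∀ {k t} → t ∈ 1… k → 1 ≤ t × t ≤ k
  ∈-1…⁻ t∈ with ∈-map⁻ suc t∈
  ... | _ , t∈′ , refl = s≤s z≤n , ∈-upTo⁻ t∈′

  1…-unique : ∀ k → Unique (1… k)
  1…-unique k = Unique.map⁺ ℕₚ.suc-injective (Unique.upTo⁺ k)

  module Unrestricted where
    open RestrictedPaths (λ _ → ⊤) (λ _ → yes tt)
    open ℰ
    open Functionals ℤ._≟_ using (functional-⨁)

    -- Repeats the map inside `𝒲`, so that `linear f` and `𝒲` agree definitionally.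
    f : ℤ → Vector
    f n = ⨁ (1… q) (λ m → a (+ m) (n -ℤ + m) • e (n -ℤ + m))
        ⊕ ⨁ (0… p) (λ m → a (-ℤ (+ m)) n • e (n +ℤ + m))

    f-transition : ∀ s m l → ⊤ → functional (δ m) (f l) ≈ transition (s , m) (suc s , l)
    f-transition s m l _ = begin
      functional (δ m) (f l)
        ≈⟨ functional-⊕ (δ m) (⨁ (1… q) (λ t → a (+ t) (l -ℤ + t) • e (l -ℤ + t))) _ ⟩
      _ ≈⟨ +-cong (functional-⨁ (δ m) (1… q) (λ t → a (+ t) (l -ℤ + t)) _)
                  (functional-⨁ (δ m) (0… p) (λ t → a (-ℤ (+ t)) l) _) ⟩
      _ ≈⟨ transition-sum (λ t → a (+ t) (l -ℤ + t)) (λ t → l -ℤ + t) (1…-unique q)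
             (λ t t∈ → let 1≤t , t≤q = ∈-1…⁻ t∈ in 1≤t , t≤q , refl , refl)
             (λ t 1≤t t≤q _ → ∈-1…⁺ 1≤t t≤q) s ⟩
      transition (s , m) (suc s , l) ∎

    open Operator ℤ._≟_ id id (λ _ → tt) f f-transition

    -- Every path satisfies the trivial predicate, so filtering by it changes nothing.
    ∑-𝒫 : ∀ n i j → W[ n , i , j ] ≈ total n (0 , i) (n , j)
    ∑-𝒫 n i j = begin
      ∑ (𝒫 n i j) weight                 ≡⟨ ≡.cong (λ γs → ∑ γs weight) (≡.sym unfiltered) ⟩
      ∑ (filter stays? (𝒫 n i j)) weight ≈⟨ ∑-filter-stays n (0 , i) (n , j) ⟩
      total n (0 , i) (n , j)            ∎
      where
      unfiltered : filter stays? (𝒫 n i j) ≡ 𝒫 n i j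
      unfiltered = filter-all stays?
        (universal (λ γ → universal (λ _ → tt) (vertices γ)) (𝒫 n i j))

    ψ≋W : ∀ i j → ψ i j ≋ W i j
    ψ≋W i j (+ _)    = ≈-refl
    ψ≋W i j -[1+ n ] = trans (inner-power n i j) (sym (∑-𝒫 n i j))

  -- ℋ is the case h = 0, shift n = n and ℋ₁ the case h = 1, shift n = n + 1;
  -- the basis vector e_n sits at height h + n.  Keeping shift apart from h +_ makes
  -- linear f agree definitionally with both operators.
  module AboveLine (h : ℕ) (shift : ℕ → ℕ) (shift≡ : ∀ n → shift n ≡ h + n) where
    open RestrictedPaths (λ y → + h ≤ℤ y) (λ y → + h ℤ.≤? y) public
    open ℰ₀
    open Functionals ℕ._≟_ using (functional-⨁)

    height : ℕ → ℤ
    height n = + (h + n)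

    f : ℕ → Vector
    f n = ⨁ (1… (n ⊓ q)) (λ m → a (+ m) (+ shift (n ∸ m)) • e (n ∸ m))
        ⊕ ⨁ (0… p) (λ m → a (-ℤ (+ m)) (+ shift n) • e (n + m))

    f-transition : ∀ s m l → + h ≤ℤ m →
      functional (δℤ m ∘ height) (f l) ≈ transition (s , m) (suc s , height l)
    f-transition s m l h≤m = begin
      functional g (f l)
        ≈⟨ functional-⊕ g (⨁ (1… (l ⊓ q)) (λ t → a (+ t) (+ shift (l ∸ t)) • e (l ∸ t))) _ ⟩
      _ ≈⟨ +-cong (functional-⨁ g (1… (l ⊓ q)) (λ t → a (+ t) (+ shift (l ∸ t))) _)
                  (functional-⨁ g (0… p) (λ t → a (-ℤ (+ t)) (+ shift l)) _) ⟩
      -- Reassociating `h + (l + t)` turns the natural-number index into the integer height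
      -- `height l +ℤ + t` expected by `transition-sum`.
      _ ≈⟨ +-congˡ (∑-cong (0… p) λ t → reflexive (≡.cong₂ (λ u v → a (-ℤ (+ t)) (+ u) *ᴿ δℤ m (+ v))
             (shift≡ l) (≡.sym (ℕₚ.+-assoc h l t)))) ⟩
      _ ≈⟨ transition-sum (λ t → a (+ t) (+ shift (l ∸ t))) (λ t → height (l ∸ t))
             (1…-unique (l ⊓ q)) sound complete s ⟩
      transition (s , m) (suc s , height l) ∎
      where
      g : ℕ → Carrier
      g = δℤ m ∘ height
      sound : ∀ t → t ∈ 1… (l ⊓ q) → 1 ≤ t × t ≤ q × height (l ∸ t) ≡ height l -ℤ + t
                                   × a (+ t) (+ shift (l ∸ t)) ≡ a (+ t) (height l -ℤ + t)
      sound t t∈ with 1≤t , t≤l⊓q ← ∈-1…⁻ t∈ =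
        1≤t , ℕₚ.≤-trans t≤l⊓q (ℕₚ.m⊓n≤n l q) , x≡ ,
        ≡.cong (a (+ t)) (≡.trans (≡.cong +_ (shift≡ (l ∸ t))) x≡)
        where
        x≡ : height (l ∸ t) ≡ height l -ℤ + t
        x≡ = ∸-height h (ℕₚ.≤-trans t≤l⊓q (ℕₚ.m⊓n≤m l q))
      complete : ∀ t → 1 ≤ t → t ≤ q → height l -ℤ + t ≡ m → t ∈ 1… (l ⊓ q)
      -- Here the boundary enters: `m` is `height l -ℤ + t` and lies on or above the line, which
      -- forces `t ≤ l`.
      complete t 1≤t t≤q refl = ∈-1…⁺ 1≤t (ℕₚ.⊓-glb (above⇒≤ h h≤m) t≤q)

    open Operator ℕ._≟_ height (ℕₚ.+-cancelˡ-≡ h _ _ ∘ ℤₚ.+-injective)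
      (λ n → ℤ.+≤+ (ℕₚ.m≤m+n h n)) f f-transition public

  φ≋A : ∀ i j → φ i j ≋ A i j
  φ≋A i j (+ _)    = ≈-refl
  -- For `h = 0` the filter `stays?` is definitionally the one that defines `𝒟`.
  φ≋A i j -[1+ n ] = trans (inner-power n i j)
                           (sym (∑-filter-stays n (0 , + i) (n , + j)))
    where open AboveLine 0 id (λ _ → refl)

  φ⁽¹⁾≋A⁽¹⁾ : ∀ i j → φ⁽¹⁾ i j ≋ A⁽¹⁾ i j
  φ⁽¹⁾≋A⁽¹⁾ i j (+ _)    = ≈-refl
  φ⁽¹⁾≋A⁽¹⁾ i j -[1+ n ] = begin
    _                                              ≈⟨ inner-power n i j ⟩
    total n (0 , + suc i) (n , + suc j)            ≈⟨ sym (∑-filter-stays n _ _) ⟩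
    ∑ (filter stays? (𝒫 n (+ suc i) (+ suc j))) weight
      -- `𝒟⁽¹⁾` is filtered twice, first at height 0 and then at height 1. The second condition
      -- implies the first, so the two filters collapse to one.
      ≡⟨ ≡.cong (λ γs → ∑ γs weight) (≡.sym (filter-filter (noPointBelow? (+ 0)) stays?
           (All.map (ℤₚ.≤-trans (ℤ.+≤+ z≤n))) (𝒫 n (+ suc i) (+ suc j)))) ⟩
    A⁽¹⁾[ n , i , j ]                              ∎
    where open AboveLine 1 (_+ 1) (λ n → ℕₚ.+-comm n 1)

theorem3p1 : ∀ {c ℓ} (R : ConjugationRing c ℓ) (p q : ℕ) → 1 ≤ p → 1 ≤ q →
    (a : ℤ → ℤ → ConjugationRing.Carrier R) →
    let open Scalars R using (_≋_)
        open Model R p q a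
    in ((i j : ℕ) → φ i j ≋ A i j)
     × ((i j : ℕ) → φ⁽¹⁾ i j ≋ A⁽¹⁾ i j)
     × ((i j : ℤ) → ψ i j ≋ W i j)
theorem3p1 R p q _ _ a = φ≋A , φ⁽¹⁾≋A⁽¹⁾ , Unrestricted.ψ≋W
  where open Resolvents R p q a
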